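{- Let $n\ge 3$ and $\varphi$ a linear functional with $\varphi(e_i)=a_i$, $0<a_1<\dots<a_n$. The flip graph of $\varphi$-monotone paths on $\diamond^n$ has diameter $2(n-1)$.
   Context: $\diamond^n=\mathrm{conv}\{\pm e_1,\dots,\pm e_n\}$. A monotone path is a sequence of vertices $-e_n=v_0,\dots,v_m=e_n$ with $v_{j-1}\neq -v_j$ and $\varphi(v_{j-1})<\varphi(v_j)$. The flip graph has the monotone paths as vertices, two paths being adjacent when they differ by a polygon flip across a 2-face; since the 2-faces of $\diamond^n$ ($n\ge3$) are triangles, this means one path is obtained from the other by inserting or deleting a single vertex. -}

module Defs where

open import Algebra.Apartness using (HeytingField)
open import Algebra.Bundles.Raw using (RawRing)
open import Algebra.Bundles using (CommutativeRing)
open import Algebra.Module.Bundles.Raw using (RawLeftModule)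
import Algebra.Module.Construct.TensorUnit as TensorUnit
open import Algebra.Module.Morphism.Structures using (module LeftModuleMorphisms)
open import Data.Bool.Base using (if_then_else_)
open import Data.Fin.Base using (Fin; fromℕ)
open import Data.Fin.Properties using (_≟_)
open import Data.List.Base using (List; removeAt; head; last)
open import Data.List.Relation.Unary.Linked using (Linked)
open import Data.Maybe.Base using (just)
open import Data.Nat.Base using (ℕ; zero; suc; NonZero; _≤_)
open import Data.Product.Base using (_×_; _,_; ∃-syntax)
open import Data.Sign.Base as Sign using (Sign)
open import Data.Sum.Base using (_⊎_)
open import Data.Vec.Functional using (Vector)
open import Function.Bundles using (_⇔_)
open import Level using (Level; _⊔_) renaming (suc to lsuc; zero to 0ℓ)
open import Relation.Binary.Bundles using (Setoid)
open import Relation.Binary.Core using (Rel)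
import Relation.Binary.Construct.On as On
open import Relation.Binary.PropositionalEquality using (_≡_; setoid)
open import Relation.Binary.Structures using (IsStrictPartialOrder)
open import Relation.Nullary.Decidable using (does)
open import Relation.Nullary.Negation using (¬_)

-- Ordered fields stand in for ℝ, which the library lacks.  Totality is
-- phrased through apartness rather than ¬ (x ≈ y), so that the constructive
-- reals are an instance as well as ℚ; with excluded middle these are the usual
-- ordered fields.

record OrderedField c ℓ₁ ℓ₂ ℓ₃ : Set (lsuc (c ⊔ ℓ₁ ⊔ ℓ₂ ⊔ ℓ₃)) where
  field
    heytingField : HeytingField c ℓ₁ ℓ₂

  open HeytingField heytingField public

  infix 4 _<_
  field
    _<_                  : Rel Carrier ℓ₃
    isStrictPartialOrder : IsStrictPartialOrder _≈_ _<_
    #⇔<⊎>                : ∀ {x y} → x # y ⇔ (x < y ⊎ y < x)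
    +-monoʳ-<            : ∀ z {x y} → x < y → z + x < z + y
    *-pos                : ∀ {x y} → 0# < x → 0# < y → 0# < x * y

  rawRing : RawRing c ℓ₁
  rawRing = CommutativeRing.rawRing
    (record { isCommutativeRing = isCommutativeRing })

-- Vertices carry a setoid equality so that proof components of a vertex
-- (see MonotonePath below) do not matter.

record Graph v ℓ a : Set (lsuc (v ⊔ ℓ ⊔ a)) where
  field
    vertices : Setoid v ℓ
    Adjacent : Rel (Setoid.Carrier vertices) a

  open Setoid vertices public using () renaming (Carrier to V; _≈_ to _≈ⱽ_)

module _ {v ℓ a} (G : Graph v ℓ a) where
  open Graph G

  data Walk : V → V → ℕ → Set (v ⊔ ℓ ⊔ a) where
    stop : ∀ {x y} → x ≈ⱽ y → Walk x y zero
    step : ∀ {x y z k} → Adjacent x y → Walk y z k → Walk x z (suc k)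

  IsDistance : V → V → ℕ → Set (v ⊔ ℓ ⊔ a)
  IsDistance x y d = Walk x y d × (∀ {k} → Walk x y k → d ≤ k)

  -- "The distance is at most d" is spelled out as "some walk has length at
  -- most d", so this says that d is the maximum of all distances (and in
  -- particular that the graph is connected).
  IsDiameter : ℕ → Set (v ⊔ ℓ ⊔ a)
  IsDiameter d = (∀ x y → ∃[ k ] (k ≤ d × Walk x y k))
               × (∃[ x ] ∃[ y ] IsDistance x y d)

module CrossPolytope {c ℓ₁ ℓ₂ ℓ₃} (F : OrderedField c ℓ₁ ℓ₂ ℓ₃) (n : ℕ) where
  open OrderedField F

  space : RawLeftModule Carrier c ℓ₁
  space = record
    { Carrierᴹ = Vector Carrier n
    ; _≈ᴹ_     = λ x y → ∀ i → x i ≈ y i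
    ; _+ᴹ_     = λ x y i → x i + y i
    ; _*ₗ_     = λ r x i → r * x i
    ; 0ᴹ       = λ _ → 0#
    ; -ᴹ_      = λ x i → - x i
    }

  open RawLeftModule space public using (_≈ᴹ_; -ᴹ_)

  IsLinearFunctional : (Vector Carrier n → Carrier) → Set (c ⊔ ℓ₁)
  IsLinearFunctional = LeftModuleMorphisms.IsLeftModuleHomomorphism
    space (TensorUnit.rawLeftModule {R = rawRing})

  e : Fin n → Vector Carrier n
  e i j = if does (i ≟ j) then 1# else 0#

  -- The label (s , i) names the vertex s eᵢ of conv {± e₁ , … , ± eₙ}.
  Vertex : Set
  Vertex = Sign × Fin n

  point : Vertex → Vector Carrier n
  point (Sign.+ , i) = e i
  point (Sign.- , i) = -ᴹ e i

lastIndex : ∀ n .{{_ : NonZero n}} → Fin n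
lastIndex (suc m) = fromℕ m

module MonotonePaths {c ℓ₁ ℓ₂ ℓ₃} (F : OrderedField c ℓ₁ ℓ₂ ℓ₃)
                     (n : ℕ) .{{_ : NonZero n}}
                     (φ : Vector (OrderedField.Carrier F) n → OrderedField.Carrier F)
                     where
  open OrderedField F using (_<_)
  open CrossPolytope F n

  -- Distinct non-antipodal vertices are exactly the ends of an edge.
  Increasing : Rel Vertex (ℓ₁ ⊔ ℓ₃)
  Increasing v w = ¬ (point v ≈ᴹ -ᴹ point w) × φ (point v) < φ (point w)

  record MonotonePath : Set (ℓ₁ ⊔ ℓ₃) where
    field
      path      : List Vertex
      starts    : head path ≡ just (Sign.- , lastIndex n)
      ends      : last path ≡ just (Sign.+ , lastIndex n)
      monotone  : Linked Increasing path

  open MonotonePath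

  _DeletesVertexOf_ : Rel MonotonePath 0ℓ
  P DeletesVertexOf Q = ∃[ i ] removeAt (path Q) i ≡ path P

  -- For n ≥ 3 the 2-faces are triangles, so a polygon flip replaces one edge
  -- of a triangle by the other two, or conversely.
  Flip : Rel MonotonePath 0ℓ
  Flip P Q = P DeletesVertexOf Q ⊎ Q DeletesVertexOf P

  flipGraph : Graph (ℓ₁ ⊔ ℓ₃) 0ℓ 0ℓ
  flipGraph = record
    { vertices = On.setoid (setoid (List Vertex)) path
    ; Adjacent = Flip
    }

{-# OPTIONS --safe #-}
module Submission where

-- φ orders the vertices as - eₙ < … < - e₁ < e₁ < … < eₙ, so a monotone path is determined by
-- the subset S of ± e₁ , … , ± eₙ₋₁ it visits, and S is admissible iff the least i for which S
-- meets {± eᵢ} exists and S contains only one of the two.  A flip toggles one element of S.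
--
-- Lower bound: all of - e₁ , … , - eₙ₋₁ and all of e₁ , … , eₙ₋₁ are admissible, and differ in
-- 2(n - 1) elements.
--
-- Upper bound: as long as exactly one of ± e₁ is selected, the rest of S is unrestricted.  If
-- S and T both omit - s e₁ for some sign s, select s e₁ in both (at most two flips) and change
-- the other 2(n - 2) elements freely.  Otherwise S and T contain opposite ones of ± e₁, and the
-- change from one to the other passes through a set with neither, which is admissible if it
-- contains exactly one of ± e₂.  Choosing that one suitably, reaching it from S and going on
-- to T costs at most two flips at ± e₂, so that 2(n - 1) flips suffice again.

open import Defs
open import Algebra.Bundles using (CommutativeRing)
import Algebra.Module.Morphism.Structures as ModuleMorphisms
import Algebra.Properties.Group as GroupProperties
import Data.Bool.Properties as Bool
open import Data.Empty using (⊥; ⊥-elim)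
open import Data.Bool.Base using (Bool; true; false; not; if_then_else_)
open import Data.Fin.Base as Fin using (Fin; zero; suc; fromℕ; inject₁; opposite)
open import Data.Fin.Properties as Fin using (toℕ<n; opposite-prop; opposite-involutive; ≤fromℕ)
open import Data.Fin.Relation.Unary.Top using (view; ‵fromℕ; ‵inject₁)
open import Data.List.Base
  using (List; []; _∷_; _++_; head; last; length; filter; removeAt; tabulate)
open import Data.List.Membership.Propositional using (_∈_)
open import Data.List.Membership.Propositional.Properties
  using (∈-++⁺ˡ; ∈-++⁺ʳ; ∈-++⁻; ∈-tabulate⁺; ∈-filter⁺; ∈-filter⁻)
import Data.List.Membership.DecPropositional as DecMembership
open import Data.List.Properties
  using (length-++; length-tabulate; filter-++; filter-all; filter-none)
open import Data.List.Relation.Binary.Subset.Propositional using (_⊆_)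
open import Data.List.Relation.Unary.All as All using (All; []; _∷_)
import Data.List.Relation.Unary.All.Properties as All
open import Data.List.Relation.Unary.AllPairs as AllPairs using (AllPairs; []; _∷_)
import Data.List.Relation.Unary.AllPairs.Properties as AllPairs
open import Data.List.Relation.Unary.Any using (here; there)
open import Data.List.Relation.Unary.Linked as Linked using (Linked; []; [-]; _∷_)
open import Data.List.Relation.Unary.Linked.Properties using (Linked⇒All; Linked⇒AllPairs)
open import Data.List.Relation.Unary.Unique.Propositional using (Unique)
open import Data.Maybe.Base using (just)
open import Data.Nat.Base using (ℕ; zero; suc; NonZero; _≤_; _+_; _*_; _∸_; z≤n; s≤s)
open import Data.Nat.Properties as ℕ using (module ≤-Reasoning)
open import Data.Nat.Tactic.RingSolver using (solve-∀)
open import Data.Product.Base using (_×_; _,_; proj₁; proj₂; ∃₂; ∃-syntax)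
open import Data.Sign.Base as Sign using (Sign)
open import Data.Sign.Properties as Sign using (s≢opposite[s])
open import Data.Sum.Base using (_⊎_; inj₁; inj₂; [_,_])
open import Data.Vec.Functional using (Vector)
open import Function.Base using (_∘_; id; case_of_)
open import Function.Bundles using (_⇔_; mk⇔; Equivalence)
open import Level using (0ℓ)
open import Relation.Binary.Core using (Rel)
open import Relation.Binary.Definitions using (DecidableEquality; Transitive; Trichotomous; tri<; tri≈; tri>)
open import Relation.Binary.PropositionalEquality
  using (_≡_; _≢_; refl; sym; trans; cong; cong₂; subst; subst₂; ≢-sym; isEquivalence)
open import Relation.Binary.Structures using (IsStrictTotalOrder; IsStrictPartialOrder)
open import Relation.Binary.Structures.Biased using (isStrictTotalOrderᶜ)
open import Relation.Nullary.Decidable using (does; yes; no; dec-true; dec-false)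
open import Relation.Nullary.Negation using (¬_; contradiction)
open import Relation.Unary using (Pred; Decidable)

-- Auxiliary facts on signs and lists.

≢⇒opposite : ∀ {s t} → s ≢ t → s ≡ Sign.opposite t
≢⇒opposite { Sign.- } { Sign.- } s≢t = contradiction refl s≢t
≢⇒opposite { Sign.- } { Sign.+ } _   = refl
≢⇒opposite { Sign.+ } { Sign.- } _   = refl
≢⇒opposite { Sign.+ } { Sign.+ } s≢t = contradiction refl s≢t

module _ {a} {A : Set a} where

  head⇒∈ : ∀ {x : A} xs → head xs ≡ just x → x ∈ xs
  head⇒∈ (_ ∷ _) refl = here refl

  last⇒∈ : ∀ {x : A} xs → last xs ≡ just x → x ∈ xs
  last⇒∈ (_ ∷ [])     refl = here refl
  last⇒∈ (_ ∷ y ∷ xs) eq   = there (last⇒∈ (y ∷ xs) eq)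

  module _ {p} {P : Pred A p} (P? : Decidable P) where

    length-filter-removeAt-≤ : ∀ xs i →
      length (filter P? (removeAt xs i)) ≤ length (filter P? xs)
    length-filter-removeAt-≤ (x ∷ xs) zero with does (P? x)
    ... | true  = ℕ.n≤1+n _
    ... | false = ℕ.≤-refl
    length-filter-removeAt-≤ (x ∷ xs) (suc i) with does (P? x)
    ... | true  = s≤s (length-filter-removeAt-≤ xs i)
    ... | false = length-filter-removeAt-≤ xs i

    length-filter-≤-removeAt : ∀ xs i →
      length (filter P? xs) ≤ suc (length (filter P? (removeAt xs i)))
    length-filter-≤-removeAt (x ∷ xs) zero with does (P? x)
    ... | true  = ℕ.≤-refl
    ... | false = ℕ.n≤1+n _
    length-filter-≤-removeAt (x ∷ xs) (suc i) with does (P? x)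
    ... | true  = s≤s (length-filter-≤-removeAt xs i)
    ... | false = length-filter-≤-removeAt xs i

-- Strictly sorted lists.

module StrictlySorted {a ℓ} {A : Set a} {_<_ : Rel A ℓ}
                      (isStrictTotalOrder : IsStrictTotalOrder _≡_ _<_) where
  private module < = IsStrictTotalOrder isStrictTotalOrder

  sorted⇒unique : ∀ {xs} → AllPairs _<_ xs → Unique xs
  sorted⇒unique = AllPairs.map λ { x<x refl → <.irrefl refl x<x }

  -- If the heads differed, each would lie in the tail of the other list, so each would be smaller
  -- than the other. Once they agree, strictness keeps the head out of both tails, so the inclusions
  -- pass to the tails.
  sorted-⊆-antisym : ∀ {xs ys} → AllPairs _<_ xs → AllPairs _<_ ys →
                     xs ⊆ ys → ys ⊆ xs → xs ≡ ys
  sorted-⊆-antisym [] []      _     _     = refl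
  sorted-⊆-antisym [] (_ ∷ _) _     ys⊆xs with () ← ys⊆xs (here refl)
  sorted-⊆-antisym (_ ∷ _) [] xs⊆ys _     with () ← xs⊆ys (here refl)
  sorted-⊆-antisym {x ∷ xs} {y ∷ ys} (x<xs ∷ sxs) (y<ys ∷ sys) xs⊆ys ys⊆xs =
    cong₂ _∷_ x≡y (sorted-⊆-antisym sxs sys
      (λ v∈xs → drop (λ { refl → <.irrefl x≡y (All.lookup x<xs v∈xs) }) (xs⊆ys (there v∈xs)))
      (λ v∈ys → drop (λ { refl → <.irrefl (sym x≡y) (All.lookup y<ys v∈ys) }) (ys⊆xs (there v∈ys))))
    where
    x≡y : x ≡ y
    x≡y with xs⊆ys (here refl) | ys⊆xs (here refl)
    ... | here x≡y   | _          = x≡y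
    ... | there _    | here y≡x   = sym y≡x
    ... | there x∈ys | there y∈xs =
      contradiction (All.lookup x<xs y∈xs) (<.asym (All.lookup y<ys x∈ys))

    drop : ∀ {v z zs} → v ≢ z → v ∈ z ∷ zs → v ∈ zs
    drop v≢z (here v≡z)   = contradiction v≡z v≢z
    drop v≢z (there v∈zs) = v∈zs

  head-minimum : ∀ {m xs} → (∀ v → ¬ v < m) → AllPairs _<_ xs → m ∈ xs → head xs ≡ just m
  head-minimum min _         (here refl)  = refl
  head-minimum min (x< ∷ _)  (there m∈xs) = contradiction (All.lookup x< m∈xs) (min _)

  last-maximum : ∀ {m xs} → (∀ v → ¬ m < v) → AllPairs _<_ xs → m ∈ xs → last xs ≡ just m
  last-maximum {xs = _ ∷ []}    max _              (here refl) = refl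
  last-maximum {xs = _ ∷ _ ∷ _} max ((m< ∷ _) ∷ _) (here refl) = contradiction m< (max _)
  last-maximum {xs = _ ∷ _ ∷ _} max (_ ∷ sxs)      (there m∈)  = last-maximum max sxs m∈

  module _ {b} (Blocked : Rel A b) where

    Between : List A → A → A → Set _
    Between xs v w = ∃[ z ] (z ∈ xs × v < z × z < w)

    -- The witness is the immediate successor of `v` in the list: it cannot be `w`, since
    -- consecutive entries are not blocked, so `w` comes after it. `Blocked` will be antipodality.
    linked⇒between : ∀ {xs v w} → Linked (λ x y → x < y × ¬ Blocked x y) xs →
                     v ∈ xs → w ∈ xs → v < w → Blocked v w → Between xs v w
    linked⇒between [-] (here refl) (here refl) v<w _ = contradiction v<w (<.irrefl refl)
    linked⇒between ((x<y , ¬b) ∷ lnk) v∈ w∈ v<w b with v∈ | w∈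
    ... | here refl | here refl         = contradiction v<w (<.irrefl refl)
    ... | here refl | there (here refl) = contradiction b ¬b
    ... | here refl | there (there w∈xs) = _ , there (here refl) , x<y ,
      All.lookup (AllPairs.head (Linked⇒AllPairs <.trans (Linked.map proj₁ lnk))) w∈xs
    ... | there v∈xs | here refl =
      contradiction v<w (<.asym (All.lookup (Linked⇒All <.trans x<y (Linked.map proj₁ lnk)) v∈xs))
    ... | there v∈xs | there w∈xs with z , z∈xs , v<z , z<w ← linked⇒between lnk v∈xs w∈xs v<w b =
      z , there z∈xs , v<z , z<w

    -- Nothing in a sorted list lies strictly between consecutive entries. The hypothesis passes to
    -- the tail because the head precedes every `v` in the tail and so is never the witness.
    between⇒linked : ∀ {xs} → AllPairs _<_ xs →
                     (∀ {v w} → v ∈ xs → w ∈ xs → v < w → Blocked v w → Between xs v w) →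
                     Linked (λ x y → x < y × ¬ Blocked x y) xs
    between⇒linked [] btw = []
    between⇒linked (_ ∷ []) btw = [-]
    between⇒linked {x ∷ y ∷ xs} ((x<y ∷ x<xs) ∷ (y<xs ∷ sxs)) btw =
      (x<y , unblocked) ∷ between⇒linked (y<xs ∷ sxs) btw′
      where
      unblocked : ¬ Blocked x y
      unblocked b with btw (here refl) (there (here refl)) x<y b
      ... | _ , here refl          , x<x , _   = <.irrefl refl x<x
      ... | _ , there (here refl)  , _   , y<y = <.irrefl refl y<y
      ... | _ , there (there z∈xs) , _   , z<y = <.asym z<y (All.lookup y<xs z∈xs)

      btw′ : ∀ {v w} → v ∈ y ∷ xs → w ∈ y ∷ xs → v < w → Blocked v w → Between (y ∷ xs) v w
      btw′ v∈ w∈ v<w b with btw (there v∈) (there w∈) v<w b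
      ... | _ , here refl , v<x , _   = contradiction v<x (<.asym (All.lookup (x<y ∷ x<xs) v∈))
      ... | z , there z∈  , v<z , z<w = z , z∈ , v<z , z<w

-- Sublists selected by Boolean predicates.

module Selecting {a} {A : Set a} (_≟_ : DecidableEquality A) where

  Selection : Set a
  Selection = A → Bool

  infixl 6 _[_≔_]

  opaque

    select : Selection → List A → List A
    select S = filter (λ v → S v Bool.≟ true)

    ∈-select⁺ : ∀ {S xs v} → v ∈ xs → S v ≡ true → v ∈ select S xs
    ∈-select⁺ {S} = ∈-filter⁺ (λ v → S v Bool.≟ true)

    ∈-select⁻ : ∀ {S} xs {v} → v ∈ select S xs → S v ≡ true
    ∈-select⁻ {S} xs = proj₂ ∘ ∈-filter⁻ (λ v → S v Bool.≟ true) {xs = xs}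

    select-sorted : ∀ {ℓ} {_<_ : Rel A ℓ} S {xs} → AllPairs _<_ xs → AllPairs _<_ (select S xs)
    select-sorted S = AllPairs.filter⁺ (λ v → S v Bool.≟ true)

    _[_≔_] : Selection → A → Bool → Selection
    (S [ v ≔ b ]) w = if does (w ≟ v) then b else S w

    update-at : ∀ S v b → (S [ v ≔ b ]) v ≡ b
    update-at S v b rewrite dec-true (v ≟ v) refl = refl

    update-off : ∀ S {v b w} → w ≢ v → (S [ v ≔ b ]) w ≡ S w
    update-off S {v} {b} {w} w≢v rewrite dec-false (w ≟ v) w≢v = refl

    select-cong : ∀ {S T} xs → (∀ v → v ∈ xs → S v ≡ T v) → select S xs ≡ select T xs
    select-cong         []       _   = refl
    select-cong {S} {T} (x ∷ xs) S≗T with S x | T x | S≗T x (here refl)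
    ... | true  | true  | refl = cong (x ∷_) (select-cong xs (λ v → S≗T v ∘ there))
    ... | false | false | refl = select-cong xs (λ v → S≗T v ∘ there)

    -- By uniqueness `v` occurs once, and past it the two selections agree. An earlier entry shifts
    -- the index by one if both selections keep it, and not at all if both drop it.
    select-removeAt : ∀ {S T v} xs → Unique xs → v ∈ xs → S v ≡ true → T v ≡ false →
                      (∀ w → w ≢ v → S w ≡ T w) → ∃[ i ] removeAt (select S xs) i ≡ select T xs
    select-removeAt {S} {T} {v} (v ∷ xs) (v∉xs ∷ _) (here refl) Sv Tv off with S v | T v
    select-removeAt (v ∷ xs) (v∉xs ∷ _) (here refl) refl refl off | true | false =
      zero , select-cong xs (λ w w∈xs → off w (≢-sym (All.lookup v∉xs w∈xs)))
    select-removeAt {S} {T} (x ∷ xs) (x∉xs ∷ uxs) (there v∈xs) Sv Tv off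
      with S x | T x | off x (All.lookup x∉xs v∈xs) | select-removeAt xs uxs v∈xs Sv Tv off
    ... | true  | true  | refl | i , eq = suc i , cong (x ∷_) eq
    ... | false | false | refl | i , eq = i , eq

-- Signed indices and their order.

module SignedIndices (n : ℕ) where

  SignedIndex : Set
  SignedIndex = Sign × Fin n

  antipode : SignedIndex → SignedIndex
  antipode (s , i) = Sign.opposite s , i

  antipode-involutive : ∀ v → antipode (antipode v) ≡ v
  antipode-involutive (s , i) = cong (_, i) (Sign.opposite-involutive s)

  infix 4 _≺_ _⋖_ _≟_

  -- A combinatorial copy of the order of the vertices by their `φ`-values.
  data _≺_ : Rel SignedIndex 0ℓ where
    neg     : ∀ {i j} → j Fin.< i → (Sign.- , i) ≺ (Sign.- , j)
    neg-pos : ∀ {i j} → (Sign.- , i) ≺ (Sign.+ , j)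
    pos     : ∀ {i j} → i Fin.< j → (Sign.+ , i) ≺ (Sign.+ , j)

  _⋖_ : Rel SignedIndex 0ℓ
  v ⋖ w = v ≺ w × w ≢ antipode v

  ≺-trans : Transitive _≺_
  ≺-trans (neg j<i) (neg k<j) = neg (Fin.<-trans k<j j<i)
  ≺-trans (neg _)   neg-pos   = neg-pos
  ≺-trans neg-pos   (pos _)   = neg-pos
  ≺-trans (pos i<j) (pos j<k) = pos (Fin.<-trans i<j j<k)

  ≺-compare : Trichotomous _≡_ _≺_
  ≺-compare (Sign.- , i) (Sign.- , j) with Fin.<-cmp i j
  ... | tri< i<j i≢j i≯j = tri> (λ { (neg j<i) → i≯j j<i }) (λ { refl → i≢j refl }) (neg i<j)
  ... | tri≈ i≮i refl _  = tri≈ (λ { (neg i<i) → i≮i i<i }) refl (λ { (neg i<i) → i≮i i<i })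
  ... | tri> i≮j i≢j j<i = tri< (neg j<i) (λ { refl → i≢j refl }) (λ { (neg i<j) → i≮j i<j })
  ≺-compare (Sign.- , i) (Sign.+ , j) = tri< neg-pos (λ ()) (λ ())
  ≺-compare (Sign.+ , i) (Sign.- , j) = tri> (λ ()) (λ ()) neg-pos
  ≺-compare (Sign.+ , i) (Sign.+ , j) with Fin.<-cmp i j
  ... | tri< i<j i≢j i≯j = tri< (pos i<j) (λ { refl → i≢j refl }) (λ { (pos j<i) → i≯j j<i })
  ... | tri≈ i≮i refl _  = tri≈ (λ { (pos i<i) → i≮i i<i }) refl (λ { (pos i<i) → i≮i i<i })
  ... | tri> i≮j i≢j j<i = tri> (λ { (pos i<j) → i≮j i<j }) (λ { refl → i≢j refl }) (pos j<i)

  ≺-isStrictTotalOrder : IsStrictTotalOrder _≡_ _≺_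
  ≺-isStrictTotalOrder = isStrictTotalOrderᶜ record
    { isEquivalence = isEquivalence ; trans = ≺-trans ; compare = ≺-compare }

  _≟_ : DecidableEquality SignedIndex
  _≟_ = IsStrictTotalOrder._≟_ ≺-isStrictTotalOrder

  opposite-antitone : ∀ {i j : Fin n} → i Fin.< j → opposite j Fin.< opposite i
  opposite-antitone {i} {j} i<j rewrite opposite-prop i | opposite-prop j =
    ℕ.∸-monoʳ-< (s≤s i<j) (toℕ<n j)

  -- `opposite` reverses the indices, so that the negative vertices too are listed in increasing
  -- order.
  negatives positives everything : List SignedIndex
  negatives  = tabulate (λ i → Sign.- , opposite i)
  positives  = tabulate (Sign.+ ,_)
  everything = negatives ++ positives

  negatives-sorted : AllPairs _≺_ negatives
  negatives-sorted = AllPairs.tabulate⁺-< (neg ∘ opposite-antitone)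

  positives-sorted : AllPairs _≺_ positives
  positives-sorted = AllPairs.tabulate⁺-< pos

  everything-sorted : AllPairs _≺_ everything
  everything-sorted = AllPairs.++⁺ negatives-sorted positives-sorted
    (All.tabulate⁺ λ _ → All.tabulate⁺ λ _ → neg-pos)

  ∈-negatives : ∀ i → (Sign.- , i) ∈ negatives
  ∈-negatives i = subst (λ j → (Sign.- , j) ∈ negatives) (opposite-involutive i) (∈-tabulate⁺ (opposite i))

  ∈-positives : ∀ i → (Sign.+ , i) ∈ positives
  ∈-positives = ∈-tabulate⁺

  negatives-are-negative : All (λ v → proj₁ v ≡ Sign.-) negatives
  negatives-are-negative = All.tabulate⁺ (λ _ → refl)

  positives-are-positive : All (λ v → proj₁ v ≡ Sign.+) positives
  positives-are-positive = All.tabulate⁺ (λ _ → refl)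

  ∈-everything : ∀ v → v ∈ everything
  ∈-everything (Sign.- , i) = ∈-++⁺ˡ (∈-negatives i)
  ∈-everything (Sign.+ , i) = ∈-++⁺ʳ negatives (∈-positives i)

  -- The vertices strictly between - eᵢ and eᵢ are the ± eⱼ with j < i, so this says that no
  -- antipodal pair is consecutive among the vertices satisfying `P`.
  Separated : ∀ {p} → Pred SignedIndex p → Set p
  Separated P = ∀ {i} → P (Sign.- , i) → P (Sign.+ , i) → ∃₂ λ s j → j Fin.< i × P (s , j)

  separated⇒between : ∀ {xs} → Separated (_∈ xs) →
    let open StrictlySorted ≺-isStrictTotalOrder in
    ∀ {v w} → v ∈ xs → w ∈ xs → v ≺ w → w ≡ antipode v → Between (λ x y → y ≡ antipode x) xs v w
  separated⇒between sep v∈ w∈ neg-pos refl with sep v∈ w∈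
  ... | Sign.- , j , j<i , z∈ = _ , z∈ , neg j<i , neg-pos
  ... | Sign.+ , j , j<i , z∈ = _ , z∈ , neg-pos , pos j<i

  linked⇒separated : ∀ {xs} → Linked _⋖_ xs → Separated (_∈ xs)
  linked⇒separated lnk v∈ w∈
    with StrictlySorted.linked⇒between ≺-isStrictTotalOrder (λ x y → y ≡ antipode x) lnk v∈ w∈ neg-pos refl
  ... | (Sign.- , j) , z∈ , neg j<i , _       = _ , j , j<i , z∈
  ... | (Sign.+ , j) , z∈ , _       , pos j<i = _ , j , j<i , z∈

-- The order of the vertices by `φ`.

module Monotone {c ℓ₁ ℓ₂ ℓ₃} (F : OrderedField c ℓ₁ ℓ₂ ℓ₃) (n : ℕ) .{{_ : NonZero n}}
                (φ : Vector (OrderedField.Carrier F) n → OrderedField.Carrier F)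
                (φ-linear : CrossPolytope.IsLinearFunctional F n φ)
                (a : Vector (OrderedField.Carrier F) n) where
  open OrderedField F
    using (_≈_; _<_; 0#; -_; +-monoʳ-<; +-assoc; +-comm; +-congˡ; +-identityʳ; -‿inverseˡ;
           isStrictPartialOrder; isCommutativeRing)
    renaming (_+_ to _⊕_; refl to ≈-refl; sym to ≈-sym; trans to ≈-trans)
  open CrossPolytope F n
  open MonotonePaths F n φ
  open SignedIndices n
  private
    module < = IsStrictPartialOrder isStrictPartialOrder
    module φ = ModuleMorphisms.LeftModuleMorphisms.IsLeftModuleHomomorphism φ-linear
    commutativeRing : CommutativeRing c ℓ₁
    commutativeRing = record { isCommutativeRing = isCommutativeRing }
    open GroupProperties (CommutativeRing.+-group commutativeRing)
      using () renaming (⁻¹-involutive to -‿involutive)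

  <-resp₂ : ∀ {x x′ y y′} → x ≈ x′ → y ≈ y′ → x < y → x′ < y′
  <-resp₂ x≈x′ y≈y′ = proj₂ <.<-resp-≈ x≈x′ ∘ proj₁ <.<-resp-≈ y≈y′

  x+y-cancel : ∀ x y → (x ⊕ - y) ⊕ y ≈ x
  x+y-cancel x y = ≈-trans (+-assoc x (- y) y) (≈-trans (+-congˡ (-‿inverseˡ y)) (+-identityʳ x))

  -- Add `- x ⊕ - y` to both sides and cancel.
  -‿anti-mono-< : ∀ {x y} → x < y → - y < - x
  -‿anti-mono-< {x} {y} = <-resp₂
    (≈-trans (+-comm _ x) (≈-trans (+-congˡ (+-comm _ _)) (≈-trans (+-comm x _) (x+y-cancel (- y) x))))
    (x+y-cancel (- x) y) ∘ +-monoʳ-< (- x ⊕ - y)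

  point≈-antipode : ∀ v → point v ≈ᴹ -ᴹ point (antipode v)
  point≈-antipode (Sign.- , i) j = ≈-refl
  point≈-antipode (Sign.+ , i) j = ≈-sym (-‿involutive _)

  module _ (φe≈a : ∀ i → φ (e i) ≈ a i) (a-positive : ∀ i → 0# < a i)
           (a-increasing : ∀ i j → i Fin.< j → a i < a j) where

    φ⁻≈-a : ∀ i → φ (point (Sign.- , i)) ≈ - a i
    φ⁻≈-a i = ≈-trans (φ.-ᴹ-homo (e i)) (OrderedField.-‿cong F (φe≈a i))

    φ-mono-≺ : ∀ {v w} → v ≺ w → φ (point v) < φ (point w)
    φ-mono-≺ (neg {i} {j} j<i) =
      <-resp₂ (≈-sym (φ⁻≈-a i)) (≈-sym (φ⁻≈-a j)) (-‿anti-mono-< (a-increasing j i j<i))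
    φ-mono-≺ (neg-pos {i} {j}) =
      <-resp₂ (≈-sym (φ⁻≈-a i)) (≈-sym (φe≈a j))
        -- The two values lie on different sides of zero.
        (<.trans (<-resp₂ ≈-refl -0≈0 (-‿anti-mono-< (a-positive i))) (a-positive j))
      where
      -0≈0 = GroupProperties.ε⁻¹≈ε (CommutativeRing.+-group commutativeRing)
    φ-mono-≺ (pos {i} {j} i<j) =
      <-resp₂ (≈-sym (φe≈a i)) (≈-sym (φe≈a j)) (a-increasing i j i<j)

    -- The case distinction is made on labels, where trichotomy is decidable, so no comparison of
    -- field elements has to be decided.
    φ-cancel-≺ : ∀ {v w} → φ (point v) < φ (point w) → v ≺ w
    φ-cancel-≺ {v} {w} φv<φw with ≺-compare v w
    ... | tri< v≺w _    _   = v≺w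
    ... | tri≈ _   refl _   = contradiction φv<φw (<.irrefl ≈-refl)
    ... | tri> _   _    w≺v = contradiction φv<φw (<.asym (φ-mono-≺ w≺v))

    φ-injective : ∀ {v w} → φ (point v) ≈ φ (point w) → v ≡ w
    φ-injective {v} {w} φv≈φw with ≺-compare v w
    ... | tri< v≺w _   _   = contradiction (φ-mono-≺ v≺w) (<.irrefl φv≈φw)
    ... | tri≈ _   v≡w _   = v≡w
    ... | tri> _   _   w≺v = contradiction (φ-mono-≺ w≺v) (<.irrefl (≈-sym φv≈φw))

    -- Labels are recovered from points by applying `φ`, which takes different values at different
    -- vertices; this avoids comparing coordinates.
    point≈-⇒antipode : ∀ {v w} → point v ≈ᴹ -ᴹ point w → w ≡ antipode v
    point≈-⇒antipode {v} {w} v≈-w = trans (sym (antipode-involutive w)) (cong antipode (sym v≡-w))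
      where
      -w≈ : point (antipode w) ≈ᴹ -ᴹ point w
      -w≈ = subst (λ u → point (antipode w) ≈ᴹ -ᴹ point u) (antipode-involutive w)
                  (point≈-antipode (antipode w))

      v≡-w : v ≡ antipode w
      v≡-w = φ-injective (φ.⟦⟧-cong (λ i → ≈-trans (v≈-w i) (≈-sym (-w≈ i))))

    -- Turns the geometry into combinatorics: the diameter argument sees `φ` only through this
    -- equivalence.
    increasing⇔ : ∀ {v w} → Increasing v w ⇔ v ⋖ w
    increasing⇔ {v} = mk⇔
      (λ (¬anti , φv<φw) → φ-cancel-≺ φv<φw , λ { refl → ¬anti (point≈-antipode v) })
      (λ (v≺w , w≢-v) → w≢-v ∘ point≈-⇒antipode , φ-mono-≺ v≺w)

-- Monotone paths as selections, flips as toggles.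

module Flips {c ℓ₁ ℓ₂ ℓ₃} (F : OrderedField c ℓ₁ ℓ₂ ℓ₃) (m : ℕ)
             (φ : Vector (OrderedField.Carrier F) (suc m) → OrderedField.Carrier F)
             (increasing⇔ : ∀ {v w} → MonotonePaths.Increasing F (suc m) φ v w ⇔ SignedIndices._⋖_ (suc m) v w)
             where
  open SignedIndices (suc m)
  open MonotonePaths F (suc m) φ
  open MonotonePath
  open StrictlySorted ≺-isStrictTotalOrder
  open Selecting _≟_
  open DecMembership _≟_ using (_∈?_)

  ⊥-minimum : ∀ v → ¬ v ≺ (Sign.- , fromℕ m)
  ⊥-minimum _ (neg {i} m<i) = ℕ.<⇒≱ m<i (≤fromℕ i)

  ⊤-maximum : ∀ v → ¬ (Sign.+ , fromℕ m) ≺ v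
  ⊤-maximum _ (pos {j = i} m<i) = ℕ.<⇒≱ m<i (≤fromℕ i)

  fromSorted : ∀ xs → AllPairs _≺_ xs → (∀ s → (s , fromℕ m) ∈ xs) → Separated (_∈ xs) → MonotonePath
  fromSorted xs sorted ends∈ sep = record
    { path     = xs
    ; starts   = head-minimum ⊥-minimum sorted (ends∈ Sign.-)
    ; ends     = last-maximum ⊤-maximum sorted (ends∈ Sign.+)
    ; monotone = Linked.map (Equivalence.from increasing⇔)
                   (between⇒linked _ sorted (separated⇒between sep))
    }

  path-linked : ∀ P → Linked _⋖_ (path P)
  path-linked P = Linked.map (Equivalence.to increasing⇔) (monotone P)

  -- Selections record the two end vertices as well, hence the first component.
  Valid : Selection → Set
  Valid S = (∀ s → S (s , fromℕ m) ≡ true) × Separated (λ v → S v ≡ true)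

  fromSelection : ∀ S → Valid S → MonotonePath
  fromSelection S (ends , sep) = fromSorted (select S everything) (select-sorted S everything-sorted)
    (λ s → ∈-select⁺ (∈-everything _) (ends s))
    λ v∈ w∈ → let s , j , j<i , Sz = sep (∈-select⁻ everything v∈) (∈-select⁻ everything w∈) in
      s , j , j<i , ∈-select⁺ (∈-everything _) Sz

  toSelection : MonotonePath → Selection
  toSelection P v = does (v ∈? path P)

  ∈⇒toSelection : ∀ P {v} → v ∈ path P → toSelection P v ≡ true
  ∈⇒toSelection P {v} = dec-true (v ∈? path P)

  toSelection⇒∈ : ∀ P {v} → toSelection P v ≡ true → v ∈ path P
  toSelection⇒∈ P {v} eq with v ∈? path P
  ... | yes v∈P = v∈P

  toSelection-valid : ∀ P → Valid (toSelection P)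
  toSelection-valid P =
    (λ { Sign.- → ∈⇒toSelection P (head⇒∈ _ (starts P))
       ; Sign.+ → ∈⇒toSelection P (last⇒∈ _ (ends P)) }) ,
    λ v∈ w∈ →
      let s , j , j<i , z∈ = linked⇒separated (path-linked P) (toSelection⇒∈ P v∈) (toSelection⇒∈ P w∈)
      in s , j , j<i , ∈⇒toSelection P z∈

  -- Both lists are sorted and have the same members, so a path is determined by its selection.
  select-toSelection : ∀ P → path P ≡ select (toSelection P) everything
  select-toSelection P = sorted-⊆-antisym
    (Linked⇒AllPairs ≺-trans (Linked.map proj₁ (path-linked P)))
    (select-sorted (toSelection P) everything-sorted)
    (λ v∈P → ∈-select⁺ (∈-everything _) (∈⇒toSelection P v∈P))
    (toSelection⇒∈ P ∘ ∈-select⁻ everything)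

  -- Paths with the same vertex list may differ in their proof components; flips depend on the list
  -- alone.
  walk-respˡ : ∀ {P Q R k} → path P ≡ path Q → Walk flipGraph Q R k → Walk flipGraph P R k
  walk-respˡ P≡Q (stop Q≡R) = stop (trans P≡Q Q≡R)
  walk-respˡ P≡Q (step (inj₁ (i , eq)) w) = step (inj₁ (i , trans eq (sym P≡Q))) w
  walk-respˡ P≡Q (step {y = R} (inj₂ del) w) =
    step (inj₂ (subst (λ xs → ∃[ i ] removeAt xs i ≡ path R) (sym P≡Q) del)) w

  walk-trans : ∀ {P Q R j k} → Walk flipGraph P Q j → Walk flipGraph Q R k → Walk flipGraph P R (j + k)
  walk-trans (stop P≡Q)  w  = walk-respˡ P≡Q w
  walk-trans (step f w′) w = step f (walk-trans w′ w)

  infix 4 _⟶[_]_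

  -- Quantifying over all paths with the given lists frees the relation from validity proofs. It
  -- holds vacuously when `S` or `T` is not valid, which is why transitivity asks for a valid middle
  -- selection. The length is only bounded, so toggles that change nothing are allowed.
  _⟶[_]_ : Selection → ℕ → Selection → Set _
  S ⟶[ d ] T = ∀ {P Q} → path P ≡ select S everything → path Q ≡ select T everything →
               ∃[ k ] (k ≤ d × Walk flipGraph P Q k)

  ⟶-trans : ∀ {S R T d e} → Valid R → S ⟶[ d ] R → R ⟶[ e ] T → S ⟶[ d + e ] T
  ⟶-trans {R = R} valid S⟶R R⟶T P≡S Q≡T
    with j , j≤d , w ← S⟶R {Q = fromSelection R valid} P≡S refl
       | k , k≤e , w′ ← R⟶T {P = fromSelection R valid} refl Q≡T =
    j + k , ℕ.+-mono-≤ j≤d k≤e , walk-trans w w′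

  delete-vertex : ∀ {S T P Q} v → S v ≡ true → T v ≡ false → (∀ w → w ≢ v → S w ≡ T w) →
                  path P ≡ select S everything → path Q ≡ select T everything → Q DeletesVertexOf P
  delete-vertex v Sv Tv off P≡S Q≡T =
    subst₂ (λ xs ys → ∃[ i ] removeAt xs i ≡ ys) (sym P≡S) (sym Q≡T)
      (select-removeAt everything (sorted⇒unique everything-sorted) (∈-everything v) Sv Tv off)

  ⟶-refl : ∀ {S T d} → (∀ w → S w ≡ T w) → S ⟶[ d ] T
  ⟶-refl S≗T P≡S Q≡T = 0 , z≤n , stop (trans P≡S (trans (select-cong everything λ v _ → S≗T v) (sym Q≡T)))

  ⟶-refl-at : ∀ {S T d} v → S v ≡ T v → (∀ w → w ≢ v → S w ≡ T w) → S ⟶[ d ] T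
  ⟶-refl-at {S} {T} v Sv≡Tv off = ⟶-refl S≗T
    where
    S≗T : ∀ w → S w ≡ T w
    S≗T w with w ≟ v
    ... | yes refl = Sv≡Tv
    ... | no w≢v   = off w w≢v

  -- If the values at `v` differ, one deletion or insertion of `v` suffices; if they agree, the walk
  -- is empty.
  toggle : ∀ {S T} v → (∀ w → w ≢ v → S w ≡ T w) → S ⟶[ 1 ] T
  toggle {S} {T} v off {P} {Q} P≡S Q≡T with S v in Sv | T v in Tv
  ... | true  | false =
    1 , ℕ.≤-refl , step (inj₂ (delete-vertex {P = P} {Q} v Sv Tv off P≡S Q≡T)) (stop {x = Q} refl)
  ... | false | true  =
    1 , ℕ.≤-refl , step (inj₁ (delete-vertex {P = Q} {P} v Tv Sv (λ w → sym ∘ off w) Q≡T P≡S)) (stop {x = Q} refl)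
  ... | true  | true  = ⟶-refl-at v (trans Sv (sym Tv)) off P≡S Q≡T
  ... | false | false = ⟶-refl-at v (trans Sv (sym Tv)) off P≡S Q≡T

  update-toggle : ∀ {S} v {b} → S ⟶[ 1 ] S [ v ≔ b ]
  update-toggle {S} v = toggle v (λ w w≢v → sym (update-off S w≢v))

  -- The elements of `l` are changed one at a time to their values in `T`. Every intermediate
  -- selection agrees at each vertex with `S` or with `T`, so validity of all such mixtures is
  -- enough.
  interpolate : ∀ {S T} l → (∀ w → w ∈ l ⊎ S w ≡ T w) →
                (∀ {R} → (∀ w → R w ≡ S w ⊎ R w ≡ T w) → Valid R) → S ⟶[ length l ] T
  interpolate {S} {T} [] off valid = ⟶-refl (λ w → [ (λ ()) , id ] (off w))
  interpolate {S} {T} (v ∷ l) off valid =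
    ⟶-trans (valid S-or-T) (update-toggle v)
      (interpolate l off′ (λ R-or → valid (λ w →
        [ (λ R≡ → [ inj₁ ∘ trans R≡ , inj₂ ∘ trans R≡ ] (S-or-T w)) , inj₂ ] (R-or w))))
    where
    S′ = S [ v ≔ T v ]

    S-or-T : ∀ w → S′ w ≡ S w ⊎ S′ w ≡ T w
    S-or-T w with w ≟ v
    ... | yes refl = inj₂ (update-at S v (T v))
    ... | no w≢v   = inj₁ (update-off S w≢v)

    off′ : ∀ w → w ∈ l ⊎ S′ w ≡ T w
    off′ w with w ≟ v
    ... | yes refl = inj₂ (update-at S v (T v))
    ... | no w≢v with off w
    ...   | inj₁ (here w≡v)  = contradiction w≡v w≢v
    ...   | inj₁ (there w∈l) = inj₁ w∈l
    ...   | inj₂ eq          = inj₂ (trans (update-off S w≢v) eq)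

  Ends : Selection → Set
  Ends S = ∀ s → S (s , fromℕ m) ≡ true

  -- Here `i` is the least index met, and exactly one of ± eᵢ is selected. That vertex separates
  -- every antipodal pair of larger index.
  lead-valid : ∀ {S} i → Ends S → S (Sign.- , i) ≢ S (Sign.+ , i) →
               (∀ t j → j Fin.< i → S (t , j) ≡ false) → Valid S
  lead-valid {S} i ends differ below = ends , separated
    where
    some-true : ∃[ t ] S (t , i) ≡ true
    some-true with S (Sign.- , i) in eq⁻ | S (Sign.+ , i) in eq⁺
    ... | true  | _     = Sign.- , eq⁻
    ... | false | true  = Sign.+ , eq⁺
    ... | false | false = contradiction refl differ

    separated : Separated (λ v → S v ≡ true)
    separated {j} S⁻ S⁺ with Fin.<-cmp i j
    ... | tri< i<j _ _    = let t , St = some-true in t , i , i<j , St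
    ... | tri≈ _ refl _   = contradiction (trans S⁻ (sym S⁺)) differ
    ... | tri> _ _ j<i with () ← trans (sym S⁻) (below Sign.- j j<i)

-- Upper bound on the distance.

module Diameter {c ℓ₁ ℓ₂ ℓ₃} (F : OrderedField c ℓ₁ ℓ₂ ℓ₃) (k : ℕ)
                (φ : Vector (OrderedField.Carrier F) (3 + k) → OrderedField.Carrier F)
                (increasing⇔ : ∀ {v w} → MonotonePaths.Increasing F (3 + k) φ v w ⇔ SignedIndices._⋖_ (3 + k) v w)
                where
  open SignedIndices (3 + k)
  open MonotonePaths F (3 + k) φ
  open MonotonePath
  open Flips F (2 + k) φ increasing⇔
  open Selecting _≟_

  Leads : Sign → Selection → Set
  Leads s S = S (s , zero) ≡ true × S (Sign.opposite s , zero) ≡ false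

  leads-valid : ∀ {S} s → Ends S → Leads s S → Valid S
  leads-valid Sign.- ends (lead , trail) =
    lead-valid zero ends (λ eq → case trans (sym lead) (trans eq trail) of λ ()) (λ _ _ ())
  leads-valid Sign.+ ends (lead , trail) =
    lead-valid zero ends (λ eq → case trans (sym lead) (trans (sym eq) trail) of λ ()) (λ _ _ ())

  -- All mixtures of `S` and `T` still lead with `s` and contain both ends, hence are valid. The
  -- indices `suc (inject₁ j)` are those other than the first and the last, the only ones at which
  -- `S` and `T` can differ.
  leads-⟶ : ∀ {S T} s l → Ends S → Ends T → Leads s S → Leads s T →
            (∀ t j → (t , suc (inject₁ j)) ∈ l ⊎ S (t , suc (inject₁ j)) ≡ T (t , suc (inject₁ j))) →
            S ⟶[ length l ] T
  leads-⟶ {S} {T} s l endsS endsT (leadS , trailS) (leadT , trailT) off = interpolate l off′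
    (λ {R} R-or → leads-valid s (λ t → common R R-or (t , _) (endsS t) (endsT t))
      (common R R-or (s , zero) leadS leadT , common R R-or (Sign.opposite s , zero) trailS trailT))
    where
    common : ∀ R → (∀ w → R w ≡ S w ⊎ R w ≡ T w) → ∀ w {b} → S w ≡ b → T w ≡ b → R w ≡ b
    common R R-or w Sw Tw with R-or w
    ... | inj₁ R≡S = trans R≡S Sw
    ... | inj₂ R≡T = trans R≡T Tw

    off′ : ∀ w → w ∈ l ⊎ S w ≡ T w
    off′ (t , zero) with t Sign.≟ s
    ... | yes refl = inj₂ (trans leadS (sym leadT))
    ... | no t≢s with refl ← ≢⇒opposite t≢s = inj₂ (trans trailS (sym trailT))
    off′ (t , suc i) with view i
    ... | ‵fromℕ     = inj₂ (trans (endsS t) (sym (endsT t)))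
    ... | ‵inject₁ j = off t j

  bothSigns : List (Fin (3 + k)) → List SignedIndex
  bothSigns []       = []
  bothSigns (i ∷ is) = (Sign.- , i) ∷ (Sign.+ , i) ∷ bothSigns is

  ∈-bothSigns : ∀ {is i} t → i ∈ is → (t , i) ∈ bothSigns is
  ∈-bothSigns Sign.- (here refl) = here refl
  ∈-bothSigns Sign.+ (here refl) = there (here refl)
  ∈-bothSigns t      (there i∈)  = there (there (∈-bothSigns t i∈))

  length-bothSigns : ∀ is → length (bothSigns is) ≡ length is * 2
  length-bothSigns []       = refl
  length-bothSigns (i ∷ is) = cong (2 +_) (length-bothSigns is)

  -- With n = 3 + k these are the n - 2 indices of e₂ , ... , eₙ₋₁ and the n - 3 indices of e₃ , ...
  -- , eₙ₋₁.
  inner core : List (Fin (3 + k))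
  inner = tabulate {n = 1 + k} (λ j → suc (inject₁ j))
  core  = tabulate {n = k} (λ j → suc (suc (inject₁ j)))

  ∈-inner : ∀ t j → (t , suc (inject₁ j)) ∈ bothSigns inner
  ∈-inner t j = ∈-bothSigns t (∈-tabulate⁺ {f = λ j → suc (inject₁ j)} j)

  ∈-core : ∀ t j → (t , suc (suc (inject₁ j))) ∈ bothSigns core
  ∈-core t j = ∈-bothSigns t (∈-tabulate⁺ {f = λ j → suc (suc (inject₁ j))} j)

  length-inner : length (bothSigns inner) ≡ (1 + k) * 2
  length-inner = trans (length-bothSigns inner)
    (cong (_* 2) (length-tabulate {n = 1 + k} (λ j → suc (inject₁ j))))

  length-core : length (bothSigns core) ≡ k * 2
  length-core = trans (length-bothSigns core)
    (cong (_* 2) (length-tabulate {n = k} (λ j → suc (suc (inject₁ j)))))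

  -- At most one flip adds `s` e₁ to `S`, at most 2(n - 2) flips adjust the inner vertices, and at
  -- most one restores the value of `T` at `s` e₁.
  common-lead : ∀ {S T} s → Valid S → Valid T →
                S (Sign.opposite s , zero) ≡ false → T (Sign.opposite s , zero) ≡ false → S ⟶[ 2 * (2 + k) ] T
  common-lead {S} {T} s validS validT trailS trailT = subst (S ⟶[_] T) length≡
    (⟶-trans (leads-valid {S [ v ≔ true ]} s endsS (leadsU {S} trailS)) (update-toggle v)
    (⟶-trans (leads-valid {T [ v ≔ true ]} s endsT (leadsU {T} trailT))
             (leads-⟶ s (bothSigns inner) endsS endsT (leadsU {S} trailS) (leadsU {T} trailT)
                      (λ t j → inj₁ (∈-inner t j)))
             (toggle v (λ _ → update-off T))))
    where
    v = s , zero

    endsS : Ends (S [ v ≔ true ])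
    endsS t = trans (update-off S (λ ())) (proj₁ validS t)

    endsT : Ends (T [ v ≔ true ])
    endsT t = trans (update-off T (λ ())) (proj₁ validT t)

    leadsU : ∀ {R} → R (Sign.opposite s , zero) ≡ false → Leads s (R [ v ≔ true ])
    leadsU {R} trail = update-at R v true ,
      trans (update-off R (λ eq → s≢opposite[s] s (sym (cong proj₁ eq)))) trail

    length≡ : 1 + (length (bothSigns inner) + 1) ≡ 2 * (2 + k)
    length≡ = trans (cong (λ l → 1 + (l + 1)) length-inner) (arith k)
      where
      arith : ∀ k → 1 + ((1 + k) * 2 + 1) ≡ 2 * (2 + k)
      arith = solve-∀

  -- W₀ below selects neither of ± e₁; its validity rests on ± e₂.
  cross-via : ∀ {S T} W s l₁ l₂ → Ends S → Ends W → Ends T →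
              Leads s S → Leads s W → Leads (Sign.opposite s) T →
              W (Sign.- , suc zero) ≢ W (Sign.+ , suc zero) →
              (∀ t j → (t , suc (inject₁ j)) ∈ l₁ ⊎ S (t , suc (inject₁ j)) ≡ W (t , suc (inject₁ j))) →
              (∀ t j → (t , suc (inject₁ j)) ∈ l₂ ⊎ W (t , suc (inject₁ j)) ≡ T (t , suc (inject₁ j))) →
              S ⟶[ length l₁ + (1 + (1 + length l₂)) ] T
  cross-via {S} {T} W s l₁ l₂ endsS endsW endsT leadsS leadsW leadsT differ off₁ off₂ =
    ⟶-trans (leads-valid s endsW leadsW) (leads-⟶ s l₁ endsS endsW leadsS leadsW off₁)
    (⟶-trans validW₀ (update-toggle (s , zero))
    (⟶-trans (leads-valid o endsW₁ leadsW₁) (update-toggle (o , zero))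
             (leads-⟶ o l₂ endsW₁ endsT leadsW₁ leadsT off₂′)))
    where
    o  = Sign.opposite s
    -- The route is `S`, `W`, `W₀`, `W₁`, `T`; its two middle steps exchange `s` e₁ for its
    -- antipode.
    W₀ = W [ (s , zero) ≔ false ]
    W₁ = W₀ [ (o , zero) ≔ true ]

    W₀-suc : ∀ t i → W₀ (t , suc i) ≡ W (t , suc i)
    W₀-suc t i = update-off W (λ ())

    W₁-suc : ∀ t i → W₁ (t , suc i) ≡ W (t , suc i)
    W₁-suc t i = trans (update-off W₀ (λ ())) (W₀-suc t i)

    trailW₀ : W₀ (o , zero) ≡ false
    trailW₀ = trans (update-off W (λ eq → s≢opposite[s] s (sym (cong proj₁ eq)))) (proj₂ leadsW)

    below : ∀ t → W₀ (t , zero) ≡ false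
    below t with t Sign.≟ s
    ... | yes refl = update-at W (s , zero) false
    ... | no t≢s with refl ← ≢⇒opposite t≢s = trailW₀

    validW₀ : Valid W₀
    validW₀ = lead-valid (suc zero) (λ t → trans (W₀-suc t _) (endsW t))
      (λ eq → differ (trans (sym (W₀-suc Sign.- zero)) (trans eq (W₀-suc Sign.+ zero))))
      (λ { t zero _ → below t ; t (suc _) (s≤s ()) })

    endsW₁ : Ends W₁
    endsW₁ t = trans (W₁-suc t _) (endsW t)

    leadsW₁ : Leads o W₁
    leadsW₁ = update-at W₀ (o , zero) true ,
      trans (update-off W₀ (λ eq → s≢opposite[s] o (sym (cong proj₁ eq))))
            (trans (cong (λ t → W₀ (t , zero)) (Sign.opposite-involutive s)) (update-at W (s , zero) false))

    off₂′ : ∀ t j → (t , suc (inject₁ j)) ∈ l₂ ⊎ W₁ (t , suc (inject₁ j)) ≡ T (t , suc (inject₁ j))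
    off₂′ t j with off₂ t j
    ... | inj₁ ∈l₂ = inj₁ ∈l₂
    ... | inj₂ W≡T = inj₂ (trans (W₁-suc t _) W≡T)

  -- If S does not distinguish - e₂ from + e₂, one toggle makes it do so; choosing the
  -- toggle so that - e₂ is then as in T leaves only + e₂ to be adjusted later.
  cross-toggling : ∀ {S T} t s → Ends S → Ends T → Leads s S → Leads (Sign.opposite s) T →
                   let v = t , suc zero ; W = S [ v ≔ not (S v) ] in
                   S (Sign.- , suc zero) ≡ S (Sign.+ , suc zero) →
                   W (Sign.- , suc zero) ≡ T (Sign.- , suc zero) → S ⟶[ 2 * (2 + k) ] T
  cross-toggling {S} {T} t s endsS endsT leadsS leadsT same match = subst (S ⟶[_] T) length≡
    (cross-via W s (v ∷ []) ((Sign.+ , suc zero) ∷ bothSigns core) endsS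
      (λ u → trans (W-off (λ ())) (endsS u)) endsT leadsS
      (trans (W-off (λ ())) (proj₁ leadsS) , trans (W-off (λ ())) (proj₂ leadsS)) leadsT
      (differ t) off₁ off₂)
    where
    v = t , suc zero
    W = S [ v ≔ not (S v) ]

    W-off : ∀ {w} → w ≢ v → W w ≡ S w
    W-off = update-off S

    differ : ∀ t → let W = S [ (t , suc zero) ≔ not (S (t , suc zero)) ] in
             W (Sign.- , suc zero) ≢ W (Sign.+ , suc zero)
    differ Sign.- eq = Bool.not-¬ (sym same)
      (trans (sym (update-off S (λ ()))) (trans (sym eq) (update-at S _ _)))
    differ Sign.+ eq = Bool.not-¬ same
      (trans (sym (update-off S (λ ()))) (trans eq (update-at S _ _)))

    off₁ : ∀ u j → (u , suc (inject₁ j)) ∈ v ∷ [] ⊎ S (u , suc (inject₁ j)) ≡ W (u , suc (inject₁ j))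
    off₁ u j with (u , suc (inject₁ j)) ≟ v
    ... | yes eq = inj₁ (here eq)
    ... | no ≢v  = inj₂ (sym (W-off ≢v))

    off₂ : ∀ u j → (u , suc (inject₁ j)) ∈ (Sign.+ , suc zero) ∷ bothSigns core ⊎
                   W (u , suc (inject₁ j)) ≡ T (u , suc (inject₁ j))
    off₂ Sign.- zero    = inj₂ match
    off₂ Sign.+ zero    = inj₁ (here refl)
    off₂ u      (suc j) = inj₁ (there (∈-core u j))

    -- One toggle leads to `W`, two act at ± e₁, one at + e₂, and at most 2(n - 3) on the core.
    length≡ : 1 + (1 + (1 + (1 + length (bothSigns core)))) ≡ 2 * (2 + k)
    length≡ = trans (cong (4 +_) length-core) (arith k)
      where
      arith : ∀ k → 4 + k * 2 ≡ 2 * (2 + k)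
      arith = solve-∀

  -- If `S` already distinguishes - e₂ from + e₂, take `W` to be `S`. Otherwise toggle + e₂ when `S`
  -- and `T` agree at - e₂, and toggle - e₂ when they do not; either way - e₂ ends up as in `T`.
  cross : ∀ {S T} s → Ends S → Ends T → Leads s S → Leads (Sign.opposite s) T → S ⟶[ 2 * (2 + k) ] T
  cross {S} {T} s endsS endsT leadsS leadsT
    with S (Sign.- , suc zero) Bool.≟ S (Sign.+ , suc zero)
       | S (Sign.- , suc zero) Bool.≟ T (Sign.- , suc zero)
  ... | yes same | yes match = cross-toggling Sign.+ s endsS endsT leadsS leadsT same
                                 (trans (update-off S (λ ())) match)
  ... | yes same | no ¬match = cross-toggling Sign.- s endsS endsT leadsS leadsT same
                                 (trans (update-at S _ _) (sym (Bool.¬-not (≢-sym ¬match))))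
  ... | no differ | _ = subst (S ⟶[_] T) (trans (cong (2 +_) length-inner) (arith k))
    (cross-via S s [] (bothSigns inner) endsS endsS endsT leadsS leadsS leadsT differ
      (λ _ _ → inj₂ refl) (λ t j → inj₁ (∈-inner t j)))
    where
    arith : ∀ k → 2 + (1 + k) * 2 ≡ 2 * (2 + k)
    arith = solve-∀

  valid⇒not-both : ∀ {S} → Valid S → S (Sign.- , zero) ≡ true → S (Sign.+ , zero) ≡ true → ⊥
  valid⇒not-both (_ , sep) S⁻ S⁺ with _ , _ , () , _ ← sep S⁻ S⁺

  -- A valid selection never contains both of ± e₁. Hence either one of the two is missing from both
  -- selections, or the selections lead with opposite signs.
  distance-≤ : ∀ {S T} → Valid S → Valid T → S ⟶[ 2 * (2 + k) ] T
  distance-≤ {S} {T} vS vT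
    with S (Sign.- , zero) in S⁻ | S (Sign.+ , zero) in S⁺ | T (Sign.- , zero) in T⁻ | T (Sign.+ , zero) in T⁺
  ... | true  | true  | _     | _     = ⊥-elim (valid⇒not-both vS S⁻ S⁺)
  ... | _     | _     | true  | true  = ⊥-elim (valid⇒not-both vT T⁻ T⁺)
  ... | _     | false | _     | false = common-lead Sign.- vS vT S⁺ T⁺
  ... | false | _     | false | _     = common-lead Sign.+ vS vT S⁻ T⁻
  ... | true  | false | false | true  = cross Sign.- (proj₁ vS) (proj₁ vT) (S⁻ , S⁺) (T⁺ , T⁻)
  ... | false | true  | true  | false = cross Sign.+ (proj₁ vS) (proj₁ vT) (S⁺ , S⁻) (T⁻ , T⁺)

  -- Lower bound by counting signs.

  has-sign? : ∀ s → Decidable (λ (v : SignedIndex) → proj₁ v ≡ s)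
  has-sign? s v = proj₁ v Sign.≟ s

  count : Sign → MonotonePath → ℕ
  count s P = length (filter (has-sign? s) (path P))

  deletion-count : ∀ s {P Q} → P DeletesVertexOf Q → count s P ≤ count s Q × count s Q ≤ 1 + count s P
  deletion-count s {P} {Q} (i , eq) =
    subst (λ xs → length (filter (has-sign? s) xs) ≤ count s Q) eq
          (length-filter-removeAt-≤ (has-sign? s) (path Q) i) ,
    subst (λ xs → count s Q ≤ 1 + length (filter (has-sign? s) xs)) eq
          (length-filter-≤-removeAt (has-sign? s) (path Q) i)

  -- The number of negative vertices minus that of positive ones falls only when a positive vertex
  -- is inserted or a negative one deleted, and then by one.
  flip-count : ∀ {P Q} → Flip P Q → count Sign.- P + count Sign.+ Q ≤ 1 + (count Sign.- Q + count Sign.+ P)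
  flip-count {P} {Q} (inj₁ del) = subst (count Sign.- P + count Sign.+ Q ≤_) (ℕ.+-suc _ _)
    (ℕ.+-mono-≤ (proj₁ (deletion-count Sign.- {P} {Q} del)) (proj₂ (deletion-count Sign.+ {P} {Q} del)))
  flip-count {P} {Q} (inj₂ del) =
    ℕ.+-mono-≤ (proj₂ (deletion-count Sign.- {Q} {P} del)) (proj₁ (deletion-count Sign.+ {Q} {P} del))

  -- The difference between the numbers of negative and of positive vertices changes by at
  -- most one per flip; it is written as a sum so that no subtraction occurs.
  walk-count : ∀ {P Q l} → Walk flipGraph P Q l →
               count Sign.- P + count Sign.+ Q ≤ l + (count Sign.- Q + count Sign.+ P)
  walk-count {P} {Q} (stop P≡Q) = ℕ.≤-reflexive (cong₂ _+_
    (cong (λ xs → length (filter (has-sign? Sign.-) xs)) P≡Q)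
    (cong (λ xs → length (filter (has-sign? Sign.+) xs)) (sym P≡Q)))
  -- With the counts of `R` added to both sides, the claim is the sum of the bounds for the first
  -- flip and for the remaining walk.
  walk-count {P} {Q} {suc l} (step {y = R} f w) = ℕ.+-cancelʳ-≤ (r⁻ + r⁺) _ _ (begin
    (p⁻ + q⁺) + (r⁻ + r⁺)             ≡⟨ swap p⁻ q⁺ r⁻ r⁺ ⟩
    (p⁻ + r⁺) + (r⁻ + q⁺)             ≤⟨ ℕ.+-mono-≤ (flip-count {P} {R} f) (walk-count w) ⟩
    (1 + (r⁻ + p⁺)) + (l + (q⁻ + r⁺)) ≡⟨ collect l p⁺ q⁻ r⁻ r⁺ ⟩
    (suc l + (q⁻ + p⁺)) + (r⁻ + r⁺)   ∎)
    where
    open ≤-Reasoning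
    p⁻ = count Sign.- P
    p⁺ = count Sign.+ P
    q⁻ = count Sign.- Q
    q⁺ = count Sign.+ Q
    r⁻ = count Sign.- R
    r⁺ = count Sign.+ R
    swap : ∀ a b c d → (a + b) + (c + d) ≡ (a + d) + (c + b)
    swap = solve-∀
    collect : ∀ l a b c d → (1 + (c + a)) + (l + (b + d)) ≡ (suc l + (b + a)) + (c + d)
    collect = solve-∀

  -- A pair at maximal distance. The only antipodal pair on either path is ± eₙ, separated by - e₁
  -- in `lower` and by e₁ in `upper`.
  lower upper : MonotonePath
  lower = fromSorted (negatives ++ (Sign.+ , fromℕ (2 + k)) ∷ [])
    (AllPairs.++⁺ negatives-sorted ([] ∷ [])
      (All.map (λ { {_ , _} refl → neg-pos ∷ [] }) negatives-are-negative))
    (λ { Sign.- → ∈-++⁺ˡ (∈-negatives _) ; Sign.+ → ∈-++⁺ʳ negatives (here refl) })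
    (λ _ +i∈ → case ∈-++⁻ negatives +i∈ of λ
      { (inj₁ +i∈) → case All.lookup negatives-are-negative +i∈ of λ ()
      ; (inj₂ (here refl)) → Sign.- , zero , s≤s z≤n , ∈-++⁺ˡ (∈-negatives zero) })
  upper = fromSorted ((Sign.- , fromℕ (2 + k)) ∷ positives)
    (All.map (λ { {_ , _} refl → neg-pos }) positives-are-positive ∷ positives-sorted)
    (λ { Sign.- → here refl ; Sign.+ → there (∈-positives _) })
    (λ { (here refl) _ → Sign.+ , zero , s≤s z≤n , there (∈-positives zero)
       ; (there -i∈) _ → case All.lookup positives-are-positive -i∈ of λ () })

  count-lower⁻ : 3 + k ≤ count Sign.- lower
  count-lower⁻ = begin
    3 + k                               ≡⟨ length-tabulate {n = 3 + k} (λ i → Sign.- , opposite i) ⟨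
    length negatives                    ≡⟨ cong length (filter-all neg? negatives-are-negative) ⟨
    length (filter neg? negatives)      ≤⟨ ℕ.m≤m+n _ _ ⟩
    length (filter neg? negatives) + _  ≡⟨ length-++ (filter neg? negatives) ⟨
    length (filter neg? negatives ++ _) ≡⟨ cong length (filter-++ neg? negatives _) ⟨
    count Sign.- lower                  ∎
    where
    open ≤-Reasoning
    neg? = has-sign? Sign.-

  count-lower⁺ : count Sign.+ lower ≡ 1
  count-lower⁺ = cong length (trans (filter-++ (has-sign? Sign.+) negatives _)
    (cong (_++ (Sign.+ , fromℕ (2 + k)) ∷ [])
      (filter-none (has-sign? Sign.+) (All.map (λ { refl () }) negatives-are-negative))))

  count-upper⁻ : count Sign.- upper ≡ 1
  count-upper⁻ = cong suc (cong length
    (filter-none (has-sign? Sign.-) (All.map (λ { refl () }) positives-are-positive)))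

  count-upper⁺ : count Sign.+ upper ≡ 3 + k
  count-upper⁺ = trans (cong length (filter-all (has-sign? Sign.+) positives-are-positive))
                       (length-tabulate {n = 3 + k} (Sign.+ ,_))

  -- The difference of the two counts goes from n - 1 at `lower` to 1 - n at `upper`, and each flip
  -- lowers it by at most one.
  distance-≥ : ∀ {l} → Walk flipGraph lower upper l → 2 * (2 + k) ≤ l
  distance-≥ {l} w = ℕ.+-cancelʳ-≤ 2 _ _ (begin
    2 * (2 + k) + 2                                 ≡⟨ arith k ⟩
    (3 + k) + (3 + k)                               ≤⟨ ℕ.+-mono-≤ count-lower⁻ (ℕ.≤-reflexive (sym count-upper⁺)) ⟩
    count Sign.- lower + count Sign.+ upper         ≤⟨ walk-count w ⟩
    l + (count Sign.- upper + count Sign.+ lower)   ≡⟨ cong (l +_) (cong₂ _+_ count-upper⁻ count-lower⁺) ⟩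
    l + 2                                           ∎)
    where
    open ≤-Reasoning
    arith : ∀ k → 2 * (2 + k) + 2 ≡ (3 + k) + (3 + k)
    arith = solve-∀

  -- The diameter.

  within : ∀ P Q → ∃[ l ] (l ≤ 2 * (2 + k) × Walk flipGraph P Q l)
  within P Q = distance-≤ (toSelection-valid P) (toSelection-valid Q)
                          (select-toSelection P) (select-toSelection Q)

  diameter : IsDiameter flipGraph (2 * (2 + k))
  diameter = within , lower , upper ,
    -- `within` bounds the length from above and `distance-≥` from below, so this walk has exactly
    -- the length that `IsDistance` demands.
    (let l , l≤ , w = within lower upper in
     subst (Walk flipGraph lower upper) (ℕ.≤-antisym l≤ (distance-≥ w)) w) , distance-≥

theorem1p1 : ∀ {c ℓ₁ ℓ₂ ℓ₃} (F : OrderedField c ℓ₁ ℓ₂ ℓ₃) →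
    let module F = OrderedField F in
    (n : ℕ) .{{_ : NonZero n}} → 3 ≤ n →
    (φ : Vector F.Carrier n → F.Carrier) → CrossPolytope.IsLinearFunctional F n φ →
    (a : Vector F.Carrier n) → (∀ i → φ (CrossPolytope.e F n i) F.≈ a i) →
    (∀ i → F.0# F.< a i) → (∀ i j → i Fin.< j → a i F.< a j) →
    IsDiameter (MonotonePaths.flipGraph F n φ) (2 * (n ∸ 1))
theorem1p1 F (suc (suc (suc k))) (s≤s (s≤s (s≤s z≤n))) φ φ-linear a φe≈a a-positive a-increasing =
  Diameter.diameter F k φ (Monotone.increasing⇔ F (3 + k) φ φ-linear a φe≈a a-positive a-increasing)
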